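{- The approximation ratio of algorithm NG for SRMA is $\Omega(\sqrt{k})$, even when the sum $\sum_j w^{(i)}_j$ of the function weights is the same for each agent $i$. That is, there is an absolute constant $c>0$ such that for all sufficiently large $k$ there is an instance $I$ of SRMA with $k$ agents, in which $\sum_j w^{(i)}_j$ is the same for all agents $i$, on which algorithm NG outputs a permutation $\pi$ with $$\max_{i\in[k]}\sum_{j} w^{(i)}_j\,\mathrm{cov}(f^{(i)}_j,\pi)\ \ge\ c\sqrt{k}\cdot\mathrm{OPT}(I).$$
   Context: **SRMA (min-max submodular ranking for multiple agents).** An instance consists of a ground set $U=[n]$, $k$ agents $a_1,\dots,a_k$, and for each agent $a_i$, monotone submodular functions $f^{(i)}_1,\dots,f^{(i)}_m:2^{[n]}\to[0,1]$ with $f^{(i)}_j(U)=1$ and weights $w^{(i)}_j>0$. For a permutation $\pi$ of $U$, the cover time $\mathrm{cov}(f,\pi)$ is the smallest index $t\in\{1,\dots,n\}$ such that $f$ has value $1$ on the set of the first $t$ elements of $\pi$. The objective value of $\pi$ is $\max_{i\in[k]}\sum_{j=1}^m w^{(i)}_j\mathrm{cov}(f^{(i)}_j,\pi)$; $\mathrm{OPT}(I)$ is its minimum over all permutations. **Algorithm NG (normalized greedy).** View all $m\cdot k$ functions as one single collection. Select elements one at a time: if $S$ is the set of elements chosen so far and $\mathcal F$ is the set of functions $f$ (among all agents) with $f(S)<1$, choose next an element $e\in U\setminus S$ maximizing $\sum_{f\in\mathcal F} w_f\cdot\frac{f(S\cup\{e\})-f(S)}{1-f(S)}$, where $w_f$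 is the weight of $f$. The order of selection is the output permutation (elements remaining after all functions are covered are appended arbitrarily). -}

module Defs where

import Algebra.Properties.CommutativeMonoid.Sum
import Algebra.Properties.Group
open import Data.Fin using (Fin; toℕ)
open import Data.Fin.Permutation using (Permutation′; _⟨$⟩ʳ_; _⟨$⟩ˡ_)
open import Data.Fin.Subset using (Subset; _∉_; _⊆_; _∪_; _∩_; ⊤; ⁅_⁆)
open import Data.Integer using (+_)
open import Data.List using (applyUpTo; find)
open import Data.Maybe using (fromMaybe)
open import Data.Nat as ℕ using (ℕ; suc; NonZero)
open import Data.Product using (_×_; ∃)
open import Data.Rational
  using (ℚ; 0ℚ; 1ℚ; _+_; _-_; _*_; _÷_; _/_; _≤_; _<_; _⊔_; ≢-nonZero)
open import Data.Rational.Properties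
  using (_≟_; _<?_; <⇒≢; +-0-group; +-0-commutativeMonoid)
open import Data.Vec using (tabulate)
import Data.Vec.Functional as Vector
open import Function using (_∘_)
open import Relation.Binary.PropositionalEquality using (_≡_; sym)
open import Relation.Nullary using (yes; no; does)

module Σℚ = Algebra.Properties.CommutativeMonoid.Sum +-0-commutativeMonoid
open Σℚ public using (sum)

SetFunction : ℕ → Set
SetFunction n = Subset n → ℚ

-- f(∅) = 0 is deliberately not required.
record IsMonotoneSubmodular {n : ℕ} (f : SetFunction n) : Set where
  field
    nonneg     : ∀ S → 0ℚ ≤ f S
    ≤one       : ∀ S → f S ≤ 1ℚ
    monotone   : ∀ S T → S ⊆ T → f S ≤ f T
    submodular : ∀ S T → f (S ∪ T) + f (S ∩ T) ≤ f S + f T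
    full       : f ⊤ ≡ 1ℚ

-- Values and weights are rational rather than real: a rational instance is
-- in particular a real one, so existence of a rational instance is at least
-- as strong.  n ≥ 1 and m ≥ 1 rule out degenerate instances in which cover
-- times are undefined or every objective value is 0.
record SRMA (k : ℕ) : Set where
  field
    n m     : ℕ
    {{n≢0}} : NonZero n
    {{m≢0}} : NonZero m
    f       : Fin k → Fin m → SetFunction n
    w       : Fin k → Fin m → ℚ
    f-valid : ∀ i j → IsMonotoneSubmodular (f i j)
    w-pos   : ∀ i j → 0ℚ < w i j

ℕ→ℚ : ℕ → ℚ
ℕ→ℚ t = + t / 1

-- π ⟨$⟩ʳ p is the element at (0-based) position p, π ⟨$⟩ˡ e the position of e.
prefix : ∀ {n} → Permutation′ n → ℕ → Subset n
prefix π t = tabulate λ e → does (toℕ (π ⟨$⟩ˡ e) ℕ.<? t)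

-- The first t in 1, …, n with f (prefix π t) ≡ 1; the default n is never
-- reached when f ⊤ ≡ 1 and n ≥ 1.
cov : ∀ {n} → SetFunction n → Permutation′ n → ℕ
cov {n} f π = fromMaybe n (find (λ t → f (prefix π t) ≟ 1ℚ) (applyUpTo suc n))

-- (f (S ∪ {e}) − f S) / (1 − f S), and 0 for functions already covered by S,
-- which do not take part in the greedy choice.
normalizedGain : ∀ {n} → SetFunction n → Subset n → Fin n → ℚ
normalizedGain f S e with f S <? 1ℚ
... | no  _    = 0ℚ
... | yes fS<1 = ((f (S ∪ ⁅ e ⁆) - f S) ÷ (1ℚ - f S)) {{≢-nonZero 1-fS≢0}}
  where
  1-fS≢0 = <⇒≢ fS<1 ∘ sym ∘ Algebra.Properties.Group.x∙y⁻¹≈ε⇒x≈y +-0-group 1ℚ (f S)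

module _ {k : ℕ} (I : SRMA k) where
  open SRMA I

  EqualTotalWeights : Set
  EqualTotalWeights = ∀ i i′ → sum (w i) ≡ sum (w i′)

  agentCost : Permutation′ n → Fin k → ℚ
  agentCost π i = sum λ j → w i j * ℕ→ℚ (cov (f i j) π)

  -- Agent costs are positive, so 0 is a harmless base value for the maximum.
  objective : Permutation′ n → ℚ
  objective π = Vector.foldr _⊔_ 0ℚ (agentCost π)

  IsOPT : ℚ → Set
  IsOPT v = (∃ λ π → objective π ≡ v) × (∀ π → v ≤ objective π)

  score : Subset n → Fin n → ℚ
  score S e = sum λ i → sum λ j → w i j * normalizedGain (f i j) S e

  -- π is a possible output: ties are broken arbitrarily.  Once every function
  -- is covered all scores are 0, so the remaining order is unconstrained.
  IsNGOutput : Permutation′ n → Set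
  IsNGOutput π = ∀ (p : Fin n) (e : Fin n) → e ∉ prefix π (toℕ p) →
    score (prefix π (toℕ p)) e ≤ score (prefix π (toℕ p)) (π ⟨$⟩ʳ p)

-- x · √k ≤ y, for x ≥ 0.
_·√_≤_ : ℚ → ℕ → ℚ → Set
x ·√ k ≤ y = 0ℚ ≤ y × (x * x) * ℕ→ℚ k ≤ y * y

{-# OPTIONS --safe #-}
-- Elements 0, …, s with n = s + 1.  Agent 0 has a function of weight n covered by
-- element 0; each other element covers a function of weight 1 for each of n agents
-- of its own.  All other functions are constantly 1 and only equalise the agents'
-- total weights.  Every unchosen element then always scores n, so every order is a
-- greedy output.  Choosing 0 last costs agent 0 more than n², while choosing it
-- first costs every agent at most 2n; and k = Θ(n²) agents are involved.
module Submission where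

open import Defs
open import Data.Fin.Permutation using (Permutation′)
open import Data.Nat as ℕ using (ℕ)
open import Data.Product using (Σ-syntax; _×_)
open import Data.Rational using (ℚ; 0ℚ; _*_; _<_)

open import Algebra.Bundles using (module CommutativeMonoid)
open import Algebra.Properties.CommutativeSemigroup using (interchange)
open import Algebra.Properties.Group using (x∙y⁻¹≈ε⇒x≈y)
open import Data.Bool using (Bool; true; false; _∧_; _∨_; if_then_else_)
open import Data.Bool.Properties using (¬-not; ∨-identityʳ; ∨-zeroʳ)
open import Data.Fin using (Fin; zero; suc; toℕ; fromℕ; splitAt; quotient; combine; _↑ˡ_; _↑ʳ_)
open import Data.Fin.Permutation using (_⟨$⟩ʳ_; _⟨$⟩ˡ_; id; reverse; inverseˡ)
open import Data.Fin.Properties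
  using (toℕ-fromℕ; toℕ<n; splitAt-↑ˡ; splitAt-↑ʳ; remQuot-combine; suc-injective)
open import Data.Fin.Subset using (Subset; _∉_; _∪_; ⁅_⁆)
open import Data.Fin.Subset.Properties using (x∈⁅x⁆; x∈⁅y⁆⇒x≡y)
import Data.Integer as ℤ
import Data.Integer.Properties as ℤ
open import Data.List using (applyUpTo; find)
open import Data.Maybe using (Maybe; just; nothing; fromMaybe)
open import Data.Nat using (zero; suc; z≤n; s≤s)
open import Data.Nat.Coprimality as Coprimality using (1-coprimeTo)
import Data.Nat.Properties as ℕ
open import Data.Nat.Tactic.RingSolver using (solve-∀)
open import Data.Product using (_,_; proj₁)
open import Data.Rational
  using (mkℚ; 1ℚ; _+_; _-_; _÷_; 1/_; _/_; _≤_; _⊔_; *≤*; NonZero; ≢-nonZero; nonNegative)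
open import Data.Rational.Properties as ℚ using (_≟_; _<?_; normalize-coprime)
open import Data.Sum using (_⊎_; inj₁; inj₂)
open import Data.Vec using (lookup)
open import Data.Vec.Properties
  using (lookup-zipWith; lookup-replicate; lookup∘tabulate; lookup⇒[]=; []=⇒lookup)
import Data.Vec.Functional as Vector
open import Function using (_∘_; const; case_of_)
open import Relation.Binary.PropositionalEquality
open import Relation.Nullary using (¬_; yes; no; contradiction; does)
open import Relation.Nullary.Decidable using (dec-true; dec-false)
open import Relation.Unary using (Decidable)

-- Natural numbers inside the rationals.

ℕ→ℚ-mkℚ : ∀ t → ℕ→ℚ t ≡ mkℚ (ℤ.+ t) 0 (Coprimality.sym (1-coprimeTo t))
-- The gcd inside `_/_` is stuck on a variable `t`; the explicit normal form lets sums and products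
-- reduce.
ℕ→ℚ-mkℚ t = normalize-coprime _

ℕ→ℚ-homo-+ : ∀ a b → ℕ→ℚ (a ℕ.+ b) ≡ ℕ→ℚ a + ℕ→ℚ b
ℕ→ℚ-homo-+ a b = sym (trans (cong₂ _+_ (ℕ→ℚ-mkℚ a) (ℕ→ℚ-mkℚ b))
  (cong (_/ 1) (cong₂ ℤ._+_ (ℤ.*-identityʳ (ℤ.+ a)) (ℤ.*-identityʳ (ℤ.+ b)))))

ℕ→ℚ-homo-* : ∀ a b → ℕ→ℚ (a ℕ.* b) ≡ ℕ→ℚ a * ℕ→ℚ b
ℕ→ℚ-homo-* a b = sym (trans (cong₂ _*_ (ℕ→ℚ-mkℚ a) (ℕ→ℚ-mkℚ b))
  (cong (_/ 1) (sym (ℤ.pos-* a b))))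

ℕ→ℚ-mono-≤ : ∀ {a b} → a ℕ.≤ b → ℕ→ℚ a ≤ ℕ→ℚ b
ℕ→ℚ-mono-≤ {a} {b} a≤b = subst₂ _≤_ (sym (ℕ→ℚ-mkℚ a)) (sym (ℕ→ℚ-mkℚ b))
  (*≤* (ℤ.*-monoʳ-≤-nonNeg (ℤ.+ 1) (ℤ.+≤+ a≤b)))

-- Finite sums, maxima and bounded search.

sum-zero : ∀ {n} (g : Fin n → ℚ) → (∀ i → g i ≡ 0ℚ) → sum g ≡ 0ℚ
sum-zero {n} g g≡0 = trans (Σℚ.sum-cong-≗ g≡0) (Σℚ.sum-replicate-zero n)

sum-single : ∀ {n} (g : Fin n → ℚ) e → (∀ i → i ≢ e → g i ≡ 0ℚ) → sum g ≡ g e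
sum-single g zero    g≡0 =
  trans (cong (g zero +_) (sum-zero (g ∘ suc) λ i → g≡0 (suc i) λ ())) (ℚ.+-identityʳ _)
sum-single g (suc e) g≡0 =
  trans (cong₂ _+_ (g≡0 zero λ ()) (sum-single (g ∘ suc) e λ i i≢e → g≡0 (suc i) (i≢e ∘ suc-injective)))
        (ℚ.+-identityˡ _)

sum-replicate : ∀ n x → sum {n} (const x) ≡ ℕ→ℚ n * x
sum-replicate zero    x = sym (ℚ.*-zeroˡ x)
sum-replicate (suc n) x = begin
  x + sum {n} (const x)      ≡⟨ cong₂ _+_ (sym (ℚ.*-identityˡ x)) (sum-replicate n x) ⟩
  1ℚ * x + ℕ→ℚ n * x         ≡⟨ ℚ.*-distribʳ-+ x 1ℚ (ℕ→ℚ n) ⟨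
  (1ℚ + ℕ→ℚ n) * x           ≡⟨ cong (_* x) (ℕ→ℚ-homo-+ 1 n) ⟨
  ℕ→ℚ (suc n) * x            ∎
  where open ≡-Reasoning

sum-split : ∀ m r (g : Fin (m ℕ.+ r) → ℚ) →
  sum g ≡ sum (λ i → g (i ↑ˡ r)) + sum (λ i → g (m ↑ʳ i))
sum-split zero    r g = sym (ℚ.+-identityˡ _)
sum-split (suc m) r g =
  trans (cong (g zero +_) (sum-split m r (g ∘ suc))) (sym (ℚ.+-assoc (g zero) _ _))

sum-combine : ∀ m n (g : Fin (m ℕ.* n) → ℚ) →
  sum g ≡ sum (λ (a : Fin m) → sum (λ (b : Fin n) → g (combine a b)))
sum-combine zero    n g = refl
sum-combine (suc m) n g =
  trans (sum-split n (m ℕ.* n) g)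
    (cong (sum (λ b → g (b ↑ˡ m ℕ.* n)) +_) (sum-combine m n (λ i → g (n ↑ʳ i))))

≤-max : ∀ {k} (g : Fin k → ℚ) i → g i ≤ Vector.foldr _⊔_ 0ℚ g
≤-max g zero    = ℚ.p≤p⊔q (g zero) _
≤-max g (suc i) = ℚ.≤-trans (≤-max (g ∘ suc) i) (ℚ.p≤q⊔p (g zero) _)

max-≤ : ∀ {k} (g : Fin k → ℚ) {v} → 0ℚ ≤ v → (∀ i → g i ≤ v) → Vector.foldr _⊔_ 0ℚ g ≤ v
max-≤ {zero}  g 0≤v g≤v = 0≤v
max-≤ {suc k} g 0≤v g≤v = ℚ.⊔-lub (g≤v zero) (max-≤ (g ∘ suc) 0≤v (g≤v ∘ suc))

find-applyUpTo : ∀ {A : Set} {P : A → Set} (P? : Decidable P) (g : ℕ → A) {n p} →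
  p ℕ.< n → P (g p) → (∀ q → q ℕ.< p → ¬ P (g q)) → find P? (applyUpTo g n) ≡ just (g p)
find-applyUpTo P? g {suc n} {zero}  p<n       Pp ¬P rewrite dec-true (P? (g 0)) Pp = refl
find-applyUpTo P? g {suc n} {suc p} (s≤s p<n) Pp ¬P
  rewrite dec-false (P? (g 0)) (¬P 0 (s≤s z≤n)) =
  find-applyUpTo P? (g ∘ suc) p<n Pp (λ q q<p → ¬P (suc q) (s≤s q<p))

-- Normalized gains.

1-x-nonZero : ∀ {x} → x < 1ℚ → NonZero (1ℚ - x)
-- The divisor proof is an irrelevant argument of `_÷_`, so this one may stand in for the proof
-- local to `normalizedGain`.
1-x-nonZero {x} x<1 = ≢-nonZero (ℚ.<⇒≢ x<1 ∘ sym ∘ x∙y⁻¹≈ε⇒x≈y ℚ.+-0-group 1ℚ x)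

normalizedGain-unchanged : ∀ {n} (f : SetFunction n) S e →
  f (S ∪ ⁅ e ⁆) ≡ f S → normalizedGain f S e ≡ 0ℚ
normalizedGain-unchanged f S e eq with f S <? 1ℚ
... | no  _    = refl
... | yes fS<1 = ratio {{1-x-nonZero fS<1}} eq
  where
  -- The two values of `f` become variables so that the equation between them can be matched with
  -- `refl`.
  ratio : ∀ {x y} .{{_ : NonZero (1ℚ - x)}} → y ≡ x → (y - x) ÷ (1ℚ - x) ≡ 0ℚ
  ratio {x} refl = trans (cong (_* 1/ (1ℚ - x)) (ℚ.+-inverseʳ x)) (ℚ.*-zeroˡ (1/ (1ℚ - x)))

normalizedGain-completed : ∀ {n} (f : SetFunction n) S e →
  f S ≡ 0ℚ → f (S ∪ ⁅ e ⁆) ≡ 1ℚ → normalizedGain f S e ≡ 1ℚ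
normalizedGain-completed f S e fS≡0 fSe≡1 with f S <? 1ℚ
... | no  fS≮1 = contradiction (subst (_< 1ℚ) (sym fS≡0) (ℚ.positive⁻¹ 1ℚ)) fS≮1
... | yes fS<1 = ratio {{1-x-nonZero fS<1}} fS≡0 fSe≡1
  where
  ratio : ∀ {x y} .{{_ : NonZero (1ℚ - x)}} → x ≡ 0ℚ → y ≡ 1ℚ → (y - x) ÷ (1ℚ - x) ≡ 1ℚ
  ratio refl refl = refl

-- Single-element coverage functions.

indicator : Bool → ℚ
indicator b = if b then 1ℚ else 0ℚ

-- just a stands for the function that is 1 exactly on the sets containing a,
-- nothing for the constant function 1.
coverage : ∀ {n} → Maybe (Fin n) → SetFunction n
coverage nothing  S = 1ℚ
coverage (just a) S = indicator (lookup S a)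

coverage-valid : ∀ {n} (t : Maybe (Fin n)) → IsMonotoneSubmodular (coverage t)
coverage-valid nothing = record
  { nonneg     = λ _ → ℚ.nonNegative⁻¹ 1ℚ
  ; ≤one       = λ _ → ℚ.≤-refl
  ; monotone   = λ _ _ _ → ℚ.≤-refl
  ; submodular = λ _ _ → ℚ.≤-refl
  ; full       = refl
  }
coverage-valid (just a) = record
  { nonneg     = λ S → nonneg (lookup S a)
  ; ≤one       = λ S → ≤one (lookup S a)
  ; monotone   = λ S T S⊆T →
      monotone (lookup S a) _ λ a∈S → []=⇒lookup (S⊆T (lookup⇒[]= a S a∈S))
  -- Equality holds: membership of a fixed element is modular.
  ; submodular = λ S T → ℚ.≤-reflexive (trans
      (cong₂ (λ x y → indicator x + indicator y)
        (lookup-zipWith _∨_ a S T) (lookup-zipWith _∧_ a S T))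
      (modular (lookup S a) (lookup T a)))
  ; full       = cong indicator (lookup-replicate a true)
  }
  where
  nonneg : ∀ x → 0ℚ ≤ indicator x
  nonneg true  = ℚ.nonNegative⁻¹ 1ℚ
  nonneg false = ℚ.≤-refl
  ≤one : ∀ x → indicator x ≤ 1ℚ
  ≤one true  = ℚ.≤-refl
  ≤one false = ℚ.nonNegative⁻¹ 1ℚ
  monotone : ∀ x y → (x ≡ true → y ≡ true) → indicator x ≤ indicator y
  monotone true  y x⇒y rewrite x⇒y refl = ℚ.≤-refl
  monotone false y x⇒y = nonneg y
  modular : ∀ x y → indicator (x ∨ y) + indicator (x ∧ y) ≡ indicator x + indicator y
  modular true  true  = refl
  modular true  false = refl
  modular false true  = refl
  modular false false = refl

lookup-∉ : ∀ {n} {e : Fin n} S → e ∉ S → lookup S e ≡ false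
lookup-∉ {e = e} S e∉S = ¬-not (e∉S ∘ lookup⇒[]= e S)

lookup-∪⁅⁆-≡ : ∀ {n} (S : Subset n) e → lookup (S ∪ ⁅ e ⁆) e ≡ true
lookup-∪⁅⁆-≡ S e = trans (lookup-zipWith _∨_ e S ⁅ e ⁆)
  (trans (cong (lookup S e ∨_) ([]=⇒lookup (x∈⁅x⁆ e))) (∨-zeroʳ _))

lookup-∪⁅⁆-≢ : ∀ {n} (S : Subset n) {a e} → a ≢ e → lookup (S ∪ ⁅ e ⁆) a ≡ lookup S a
lookup-∪⁅⁆-≢ S {a} {e} a≢e = trans (lookup-zipWith _∨_ a S ⁅ e ⁆)
  (trans (cong (lookup S a ∨_) (lookup-∉ ⁅ e ⁆ (a≢e ∘ x∈⁅y⁆⇒x≡y e))) (∨-identityʳ _))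

gain-nothing : ∀ {n} (S : Subset n) e → normalizedGain (coverage nothing) S e ≡ 0ℚ
gain-nothing S e = normalizedGain-unchanged (coverage nothing) S e refl

gain-≡ : ∀ {n} (S : Subset n) e → e ∉ S → normalizedGain (coverage (just e)) S e ≡ 1ℚ
gain-≡ S e e∉S = normalizedGain-completed (coverage (just e)) S e
  (cong indicator (lookup-∉ S e∉S)) (cong indicator (lookup-∪⁅⁆-≡ S e))

gain-≢ : ∀ {n} (S : Subset n) {a e} → a ≢ e → normalizedGain (coverage (just a)) S e ≡ 0ℚ
gain-≢ S {a} {e} a≢e = normalizedGain-unchanged (coverage (just a)) S e
  (cong indicator (lookup-∪⁅⁆-≢ S a≢e))

-- Prefixes and cover times.

lookup-prefix : ∀ {n} (π : Permutation′ n) t a →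
  lookup (prefix π t) a ≡ does (toℕ (π ⟨$⟩ˡ a) ℕ.<? t)
lookup-prefix π t a = lookup∘tabulate _ a

-- The search starts at index 1, so a constant function still costs its weight once. On an empty
-- ground set the default 0 would be returned instead.
cov-nothing : ∀ {s} (π : Permutation′ (suc s)) → cov (coverage nothing) π ≡ 1
cov-nothing π = refl

-- A prefix of length `t` holds the elements whose 0-based position is below `t`, so the first
-- success is one more than the position of `a`.
cov-just : ∀ {n} (π : Permutation′ n) a → cov (coverage (just a)) π ≡ suc (toℕ (π ⟨$⟩ˡ a))
cov-just {n} π a = cong (fromMaybe n) (find-applyUpTo (λ t → coverage (just a) (prefix π t) ≟ 1ℚ) suc
  (toℕ<n (π ⟨$⟩ˡ a)) covered uncovered)
  where
  pos = toℕ (π ⟨$⟩ˡ a)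
  covered : coverage (just a) (prefix π (suc pos)) ≡ 1ℚ
  covered = cong indicator (trans (lookup-prefix π (suc pos) a) (dec-true (pos ℕ.<? suc pos) ℕ.≤-refl))
  uncovered : ∀ q → q ℕ.< pos → coverage (just a) (prefix π (suc q)) ≢ 1ℚ
  uncovered q q<pos eq = case trans (sym eq) (cong indicator
    (trans (lookup-prefix π (suc q) a) (dec-false (pos ℕ.<? suc q) (ℕ.≤⇒≯ q<pos)))) of λ ()

cov≤n : ∀ {s} (t : Maybe (Fin (suc s))) π → cov (coverage t) π ℕ.≤ suc s
cov≤n nothing  π = s≤s z≤n
cov≤n (just a) π = subst (ℕ._≤ _) (sym (cov-just π a)) (toℕ<n (π ⟨$⟩ˡ a))

∉prefix : ∀ {n} (π : Permutation′ n) p → π ⟨$⟩ʳ p ∉ prefix π (toℕ p)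
∉prefix π p p∈ = case trans (sym ([]=⇒lookup p∈)) (trans (lookup-prefix π (toℕ p) (π ⟨$⟩ʳ p))
  (dec-false (toℕ (π ⟨$⟩ˡ (π ⟨$⟩ʳ p)) ℕ.<? toℕ p)
    (ℕ.<-irrefl (cong toℕ (inverseˡ π))))) of λ ()

-- The difference is `(n - 1)²`, written out for `n = 2 + m` below. It serves the lower bound on the
-- optimum when element 0 comes last.
n+n≤n*n+1 : ∀ n → n ℕ.+ n ℕ.≤ n ℕ.* n ℕ.+ 1
n+n≤n*n+1 zero          = z≤n
n+n≤n*n+1 (suc zero)    = ℕ.≤-refl
n+n≤n*n+1 (suc (suc m)) = subst (2 ℕ.+ m ℕ.+ (2 ℕ.+ m) ℕ.≤_) (identity m)
  (ℕ.m≤m+n (2 ℕ.+ m ℕ.+ (2 ℕ.+ m)) (m ℕ.* m ℕ.+ 2 ℕ.* m ℕ.+ 1))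
  where
  identity : ∀ m → (2 ℕ.+ m ℕ.+ (2 ℕ.+ m)) ℕ.+ (m ℕ.* m ℕ.+ 2 ℕ.* m ℕ.+ 1) ≡ (2 ℕ.+ m) ℕ.* (2 ℕ.+ m) ℕ.+ 1
  identity = solve-∀

-- The hard instance.

module HardInstance (s r : ℕ) where

  n k : ℕ
  n = suc s
  k = suc (s ℕ.* n ℕ.+ r)

  -- After agent 0 come `s` blocks of `n` agents, one block per element other than 0, and then `r`
  -- padding agents with constant functions only. Padding affects no score and absorbs the
  -- difference between `k` and `suc (s * n)`.
  toGroup : Fin (s ℕ.* n) ⊎ Fin r → Maybe (Fin n)
  toGroup (inj₁ x) = just (suc (quotient {s} n x))
  toGroup (inj₂ _) = nothing

  group : Fin (s ℕ.* n ℕ.+ r) → Maybe (Fin n)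
  group i = toGroup (splitAt (s ℕ.* n) i)

  group-combine : ∀ (a : Fin s) (b : Fin n) → group (combine {s} {n} a b ↑ˡ r) ≡ just (suc a)
  group-combine a b = trans (cong toGroup (splitAt-↑ˡ (s ℕ.* n) (combine a b) r))
    (cong (just ∘ suc ∘ proj₁) (remQuot-combine {s} {n} a b))

  group-↑ʳ : ∀ i → group ((s ℕ.* n) ↑ʳ i) ≡ nothing
  group-↑ʳ i = cong toGroup (splitAt-↑ʳ (s ℕ.* n) r i)

  target : Fin k → Fin 2 → Maybe (Fin n)
  target zero    zero       = just zero
  target zero    (suc zero) = nothing
  target (suc i) zero       = nothing
  target (suc i) (suc zero) = group i

  -- The weight depends on the slot alone, so equality of the agents' totals is `refl`.
  weight : Fin 2 → ℕ
  weight zero       = n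
  weight (suc zero) = 1

  weight-pos : ∀ j → 0ℚ < ℕ→ℚ (weight j)
  weight-pos zero       = ℚ.positive⁻¹ (ℕ→ℚ n) {{ℚ.normalize-pos n 1}}
  weight-pos (suc zero) = ℚ.positive⁻¹ 1ℚ

  instanceI : SRMA k
  instanceI = record
    { n       = n
    ; m       = 2
    ; f       = λ i j → coverage (target i j)
    ; w       = λ _ j → ℕ→ℚ (weight j)
    ; f-valid = λ i j → coverage-valid (target i j)
    ; w-pos   = λ _ → weight-pos
    }

  -- Constant functions are covered from the start, and a single-element function gains only from
  -- its own element, where it gains 1. What remains is one weight `n` for element 0, or `n` weights
  -- 1 for any other element.
  score-unchosen : ∀ S e → e ∉ S → score instanceI S e ≡ ℕ→ℚ n
  score-unchosen S e e∉S = begin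
    (N * γ (just zero) + (1ℚ * γ nothing + 0ℚ)) + sum (λ i → N * γ nothing + (1ℚ * γ (group i) + 0ℚ))
      ≡⟨ cong₂ _+_ special (Σℚ.sum-cong-≗ ordinary) ⟩
    N * γ (just zero) + sum (γ ∘ group)
      ≡⟨ cong (N * γ (just zero) +_) groups ⟩
    -- The sum over agents is now a sum over elements, each of total weight `N`, with element 0 as
    -- its head; only the term at `e` survives.
    sum (λ a → N * γ (just a))
      ≡⟨ sum-single (λ a → N * γ (just a)) e
           (λ a a≢e → trans (cong (N *_) (gain-≢ S a≢e)) (ℚ.*-zeroʳ N)) ⟩
    N * γ (just e)
      ≡⟨ trans (cong (N *_) (gain-≡ S e e∉S)) (ℚ.*-identityʳ N) ⟩
    N ∎
    where
    open ≡-Reasoning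
    N = ℕ→ℚ n
    γ : Maybe (Fin n) → ℚ
    γ t = normalizedGain (coverage t) S e
    special : N * γ (just zero) + (1ℚ * γ nothing + 0ℚ) ≡ N * γ (just zero)
    special rewrite gain-nothing S e = ℚ.+-identityʳ (N * γ (just zero))
    ordinary : ∀ i → N * γ nothing + (1ℚ * γ (group i) + 0ℚ) ≡ γ (group i)
    ordinary i rewrite gain-nothing S e | ℚ.*-zeroʳ N =
      trans (ℚ.+-identityˡ (1ℚ * γ (group i) + 0ℚ))
        (trans (ℚ.+-identityʳ (1ℚ * γ (group i))) (ℚ.*-identityˡ (γ (group i))))
    groups : sum (γ ∘ group) ≡ sum (λ a → N * γ (just (suc a)))
    groups = begin
      sum (γ ∘ group)
        ≡⟨ sum-split (s ℕ.* n) r (γ ∘ group) ⟩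
      sum (λ i → γ (group (i ↑ˡ r))) + sum (λ i → γ (group ((s ℕ.* n) ↑ʳ i)))
        ≡⟨ cong₂ _+_ (sum-combine s n (λ i → γ (group (i ↑ˡ r))))
             (sum-zero (λ i → γ (group ((s ℕ.* n) ↑ʳ i))) λ i → trans (cong γ (group-↑ʳ i)) (gain-nothing S e)) ⟩
      sum (λ a → sum (λ b → γ (group (combine {s} {n} a b ↑ˡ r)))) + 0ℚ
        ≡⟨ ℚ.+-identityʳ _ ⟩
      sum (λ a → sum (λ b → γ (group (combine {s} {n} a b ↑ˡ r))))
        ≡⟨ Σℚ.sum-cong-≗ (λ a → trans (Σℚ.sum-cong-≗ λ b → cong γ (group-combine a b))
             (sum-replicate n (γ (just (suc a))))) ⟩
      sum (λ a → N * γ (just (suc a))) ∎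

  every-order-is-greedy : ∀ π → IsNGOutput instanceI π
  every-order-is-greedy π p e e∉ = ℚ.≤-reflexive (trans
    (score-unchosen (prefix π (toℕ p)) e e∉)
    (sym (score-unchosen (prefix π (toℕ p)) (π ⟨$⟩ʳ p) (∉prefix π p))))

  -- Agent costs, computed in `ℕ`, and the optimum.

  cost : Permutation′ n → Fin k → ℕ
  cost π i = n ℕ.* cov (coverage (target i zero)) π ℕ.+ cov (coverage (target i (suc zero))) π

  agentCost≡cost : ∀ π i → agentCost instanceI π i ≡ ℕ→ℚ (cost π i)
  agentCost≡cost π i = sym (trans (ℕ→ℚ-homo-+ (n ℕ.* c₀) c₁) (cong₂ _+_ (ℕ→ℚ-homo-* n c₀)
    (sym (trans (ℚ.+-identityʳ (1ℚ * ℕ→ℚ c₁)) (ℚ.*-identityˡ (ℕ→ℚ c₁))))))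
    where
    c₀ = cov (coverage (target i zero)) π
    c₁ = cov (coverage (target i (suc zero))) π

  cost≤objective : ∀ π i → ℕ→ℚ (cost π i) ≤ objective instanceI π
  cost≤objective π i = subst (_≤ _) (agentCost≡cost π i) (≤-max (agentCost instanceI π) i)

  objective≤ : ∀ π {v} → (∀ i → cost π i ℕ.≤ v) → objective instanceI π ≤ ℕ→ℚ v
  objective≤ π {v} cost≤v = max-≤ (agentCost instanceI π) (ℕ→ℚ-mono-≤ {0} {v} z≤n)
    λ i → subst (_≤ _) (sym (agentCost≡cost π i)) (ℕ→ℚ-mono-≤ {cost π i} {v} (cost≤v i))

  cost-special : ∀ π → cost π zero ≡ n ℕ.* suc (toℕ (π ⟨$⟩ˡ zero)) ℕ.+ 1
  cost-special π = cong₂ (λ x y → n ℕ.* x ℕ.+ y) (cov-just π zero) (cov-nothing π)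

  cost-ordinary : ∀ π i → cost π (suc i) ≡ n ℕ.+ cov (coverage (group i)) π
  cost-ordinary π i = cong (ℕ._+ cov (coverage (group i)) π) (ℕ.*-identityʳ n)

  cost-special-last : ∀ π → toℕ (π ⟨$⟩ˡ zero) ≡ s → cost π zero ≡ n ℕ.* n ℕ.+ 1
  cost-special-last π last = trans (cost-special π) (cong (λ p → n ℕ.* suc p ℕ.+ 1) last)

  -- With element 0 first, agent 0 pays `n + 1`. Every other agent pays `n` for the constant
  -- function in the heavy slot and at most `n` in the light one.
  objective-id : objective instanceI id ≤ ℕ→ℚ (n ℕ.+ n)
  objective-id = objective≤ id bound
    where
    bound : ∀ i → cost id i ℕ.≤ n ℕ.+ n
    bound zero    = ℕ.≤-trans
      (ℕ.≤-reflexive (trans (cost-special id) (cong (ℕ._+ 1) (ℕ.*-identityʳ n))))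
      (ℕ.+-monoʳ-≤ n (s≤s z≤n))
    bound (suc i) = ℕ.≤-trans (ℕ.≤-reflexive (cost-ordinary id i))
      (ℕ.+-monoʳ-≤ n (cov≤n (group i) id))

  -- Whichever element π puts last, some agent needing it has cost at least 2n.
  objective-lower : ∀ π → ℕ→ℚ (n ℕ.+ n) ≤ objective instanceI π
  objective-lower π = by-last-element (π ⟨$⟩ʳ fromℕ s)
    (trans (cong toℕ (inverseˡ π)) (toℕ-fromℕ s))
    where
    by-last-element : ∀ e → toℕ (π ⟨$⟩ˡ e) ≡ s → ℕ→ℚ (n ℕ.+ n) ≤ objective instanceI π
    by-last-element zero    last = ℚ.≤-trans
      (ℕ→ℚ-mono-≤ {n ℕ.+ n} {cost π zero} (ℕ.≤-trans (n+n≤n*n+1 n) (ℕ.≤-reflexive (sym (cost-special-last π last)))))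
      (cost≤objective π zero)
    by-last-element (suc a) last = ℚ.≤-trans
      (ℕ→ℚ-mono-≤ {n ℕ.+ n} {cost π (suc i)} (ℕ.≤-reflexive (sym (trans (cost-ordinary π i) (cong (n ℕ.+_) cov≡n)))))
      (cost≤objective π (suc i))
      where
      i = combine {s} {n} a zero ↑ˡ r
      cov≡n : cov (coverage (group i)) π ≡ n
      cov≡n = trans (cong (λ t → cov (coverage t) π) (group-combine a zero))
        (trans (cov-just π (suc a)) (cong suc last))

  isOPT : IsOPT instanceI (ℕ→ℚ (n ℕ.+ n))
  isOPT = (id , ℚ.≤-antisym objective-id (objective-lower id)) , objective-lower

  -- `reverse` moves element 0 to the last position `s`, so agent 0 pays `n * n + 1`.
  objective-reverse : ℕ→ℚ (n ℕ.* n) ≤ objective instanceI reverse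
  objective-reverse = ℚ.≤-trans
    (ℕ→ℚ-mono-≤ {n ℕ.* n} {cost reverse zero} (ℕ.≤-trans (ℕ.m≤m+n (n ℕ.* n) 1)
      (ℕ.≤-reflexive (sym (cost-special-last reverse (toℕ-fromℕ s))))))
    (cost≤objective reverse zero)

-- The ratio in terms of the number of agents.

·√-bound : ∀ {c d} {x y k : ℕ} {z} → c * c * ℕ→ℚ d ≡ 1ℚ → 0ℚ ≤ c * c →
  x ℕ.* x ℕ.* k ℕ.≤ d ℕ.* (y ℕ.* y) → ℕ→ℚ y ≤ z → (c * ℕ→ℚ x) ·√ k ≤ z
-- Since `c * c` is the inverse of `d`, scaling the inequality in `ℕ` by it leaves `y * y` on the
-- right, and `y ≤ z` finishes.
·√-bound {c} {d} {x} {y} {k} {z} ccd≡1 0≤cc xxk≤dyy y≤z = 0≤z , (begin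
  (c * X * (c * X)) * ℕ→ℚ k        ≡⟨ cong (_* ℕ→ℚ k) (interchange *-commutativeSemigroup c X c X) ⟩
  (c * c * (X * X)) * ℕ→ℚ k        ≡⟨ ℚ.*-assoc (c * c) (X * X) (ℕ→ℚ k) ⟩
  c * c * (X * X * ℕ→ℚ k)          ≡⟨ cong (λ u → c * c * (u * ℕ→ℚ k)) (ℕ→ℚ-homo-* x x) ⟨
  c * c * (ℕ→ℚ (x ℕ.* x) * ℕ→ℚ k)  ≡⟨ cong (c * c *_) (ℕ→ℚ-homo-* (x ℕ.* x) k) ⟨
  c * c * ℕ→ℚ (x ℕ.* x ℕ.* k)      ≤⟨ ℚ.*-monoˡ-≤-nonNeg (c * c) {{nonNegative 0≤cc}} (ℕ→ℚ-mono-≤ {x ℕ.* x ℕ.* k} {d ℕ.* (y ℕ.* y)} xxk≤dyy) ⟩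
  c * c * ℕ→ℚ (d ℕ.* (y ℕ.* y))    ≡⟨ cong (c * c *_) (ℕ→ℚ-homo-* d (y ℕ.* y)) ⟩
  c * c * (ℕ→ℚ d * ℕ→ℚ (y ℕ.* y))  ≡⟨ ℚ.*-assoc (c * c) (ℕ→ℚ d) (ℕ→ℚ (y ℕ.* y)) ⟨
  c * c * ℕ→ℚ d * ℕ→ℚ (y ℕ.* y)    ≡⟨ cong (_* ℕ→ℚ (y ℕ.* y)) ccd≡1 ⟩
  1ℚ * ℕ→ℚ (y ℕ.* y)               ≡⟨ ℚ.*-identityˡ _ ⟩
  ℕ→ℚ (y ℕ.* y)                    ≡⟨ ℕ→ℚ-homo-* y y ⟩
  ℕ→ℚ y * ℕ→ℚ y                    ≤⟨ ℚ.*-monoˡ-≤-nonNeg (ℕ→ℚ y) {{nonNegative 0≤y}} y≤z ⟩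
  ℕ→ℚ y * z                        ≤⟨ ℚ.*-monoʳ-≤-nonNeg z {{nonNegative 0≤z}} y≤z ⟩
  z * z                            ∎)
  where
  open ℚ.≤-Reasoning
  *-commutativeSemigroup = CommutativeMonoid.commutativeSemigroup ℚ.*-1-commutativeMonoid
  X = ℕ→ℚ x
  0≤y : 0ℚ ≤ ℕ→ℚ y
  0≤y = ℕ→ℚ-mono-≤ {0} {y} z≤n
  0≤z : 0ℚ ≤ z
  0≤z = ℚ.≤-trans 0≤y y≤z

-- Consecutive numbers `s * suc s` differ by `2s + 2`, so the remainder runs up to `2s + 1` before
-- `s` increases and it resets to 0.
pronic-remainder : ∀ k → Σ[ s ∈ ℕ ] Σ[ r ∈ ℕ ]
  r ℕ.≤ suc (s ℕ.+ s) × k ≡ s ℕ.* suc s ℕ.+ r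
pronic-remainder zero = 0 , 0 , z≤n , refl
pronic-remainder (suc k) with pronic-remainder k
... | s , r , r≤ , refl with r ℕ.≟ suc (s ℕ.+ s)
...   | no  r≢   = s , suc r , ℕ.≤∧≢⇒< r≤ r≢ , sym (ℕ.+-suc (s ℕ.* suc s) r)
...   | yes refl = suc s , 0 , z≤n , identity s
  where
  identity : ∀ s → suc (s ℕ.* suc s ℕ.+ suc (s ℕ.+ s)) ≡ suc s ℕ.* suc (suc s) ℕ.+ 0
  identity = solve-∀

-- With `n = suc s`, dividing by `4n²` leaves the claim that the number of agents is at most `4n²`;
-- it is in fact at most `s² + 3s + 2`.
agents-bound : ∀ s {r} → r ℕ.≤ suc (s ℕ.+ s) →
  (suc s ℕ.+ suc s) ℕ.* (suc s ℕ.+ suc s) ℕ.* suc (s ℕ.* suc s ℕ.+ r)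
    ℕ.≤ 16 ℕ.* ((suc s ℕ.* suc s) ℕ.* (suc s ℕ.* suc s))
agents-bound s {r} r≤ = begin
  4n² ℕ.* suc (s ℕ.* suc s ℕ.+ r)
    ≤⟨ ℕ.*-monoʳ-≤ 4n² (s≤s (ℕ.+-monoʳ-≤ (s ℕ.* suc s) r≤)) ⟩
  4n² ℕ.* suc (s ℕ.* suc s ℕ.+ suc (s ℕ.+ s))
    -- The added polynomial is the slack `4n² - (s² + 3s + 2)`.
    ≤⟨ ℕ.*-monoʳ-≤ 4n² (ℕ.m≤m+n _ (3 ℕ.* (s ℕ.* s) ℕ.+ 5 ℕ.* s ℕ.+ 2)) ⟩
  4n² ℕ.* (suc (s ℕ.* suc s ℕ.+ suc (s ℕ.+ s)) ℕ.+ (3 ℕ.* (s ℕ.* s) ℕ.+ 5 ℕ.* s ℕ.+ 2))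
    ≡⟨ identity s ⟩
  16 ℕ.* ((suc s ℕ.* suc s) ℕ.* (suc s ℕ.* suc s)) ∎
  where
  open ℕ.≤-Reasoning
  4n² = (suc s ℕ.+ suc s) ℕ.* (suc s ℕ.+ suc s)
  identity : ∀ s →
    (suc s ℕ.+ suc s) ℕ.* (suc s ℕ.+ suc s) ℕ.*
      (suc (s ℕ.* suc s ℕ.+ suc (s ℕ.+ s)) ℕ.+ (3 ℕ.* (s ℕ.* s) ℕ.+ 5 ℕ.* s ℕ.+ 2))
    ≡ 16 ℕ.* ((suc s ℕ.* suc s) ℕ.* (suc s ℕ.* suc s))
  identity = solve-∀

-- The constant 1/4 comes from `√k ≤ 2n`: a quarter of `2n` times `√k` is at most `n²`.
ratio-bound : ∀ s r → r ℕ.≤ suc (s ℕ.+ s) → let open HardInstance s r in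
  ((ℤ.+ 1 / 4) * ℕ→ℚ (n ℕ.+ n)) ·√ k ≤ objective instanceI reverse
ratio-bound s r r≤ =
  ·√-bound {ℤ.+ 1 / 4} {16} {n ℕ.+ n} {n ℕ.* n} {k} {objective instanceI reverse}
    refl (ℚ.nonNegative⁻¹ ((ℤ.+ 1 / 4) * (ℤ.+ 1 / 4))) (agents-bound s r≤) objective-reverse
  where open HardInstance s r

-- Serves as the motive for transporting along the decomposition of `k`, which is only a
-- propositional equality.
Gap : ℕ → Set
Gap k = Σ[ I ∈ SRMA k ] EqualTotalWeights I ×
  (Σ[ π ∈ Permutation′ (SRMA.n I) ] IsNGOutput I π ×
  (Σ[ opt ∈ ℚ ] IsOPT I opt × ((ℤ.+ 1 / 4) * opt) ·√ k ≤ objective I π))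

gap : ∀ s r → r ℕ.≤ suc (s ℕ.+ s) → Gap (suc (s ℕ.* suc s ℕ.+ r))
gap s r r≤ = instanceI , (λ _ _ → refl) , reverse , every-order-is-greedy reverse ,
  ℕ→ℚ (n ℕ.+ n) , isOPT , ratio-bound s r r≤
  where open HardInstance s r

theorem1 : Σ[ c ∈ ℚ ] 0ℚ < c × (Σ[ K ∈ ℕ ] ((k : ℕ) → K ℕ.≤ k →
    Σ[ I ∈ SRMA k ] EqualTotalWeights I ×
    (Σ[ π ∈ Permutation′ (SRMA.n I) ] IsNGOutput I π ×
    (Σ[ opt ∈ ℚ ] IsOPT I opt × (c * opt) ·√ k ≤ objective I π))))
theorem1 = ℤ.+ 1 / 4 , ℚ.positive⁻¹ (ℤ.+ 1 / 4) , 1 , λ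
  -- The threshold 1 excludes just `k = 0`. The predecessor is decomposed because agent 0 stands
  -- outside the blocks and the padding.
  { (suc k) _ → let s , r , r≤ , k≡ = pronic-remainder k in
      subst Gap (cong suc (sym k≡)) (gap s r r≤) }
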